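{- Let $t,p$ be terms of the $\lambda!$-calculus. If $t\twoheadrightarrow_{\mathtt w}^{(b,e)}p$ with $p\in\mathsf{no}_{\mathtt{wcf}}$, then there exist $\Gamma$, $\sigma$ and a tight derivation in system $\mathcal E$ of $\Gamma\vdash^{(b,e,|p|_{\mathtt w})}t:\sigma$.
   Context: Terms of the $\lambda!$-calculus: $t,u ::= x \mid t\,u \mid \lambda x.t \mid {!t} \mid \mathrm{der}\,t \mid t[x\backslash u]$, where $[x\backslash u]$ is a syntactic explicit substitution; $\lambda x.t$ and $t[x\backslash u]$ bind $x$ in $t$; terms are modulo $\alpha$-conversion. $t\{x\backslash u\}$ is capture-avoiding meta-level substitution. List contexts: $L ::= \Box \mid L[x\backslash t]$. Weak contexts: $W ::= \Box \mid W\,t \mid t\,W \mid \lambda x.W \mid \mathrm{der}\,W \mid W[x\backslash u] \mid t[x\backslash W]$. Rules (avoiding capture): $\mathtt{dB}$: $L\langle\lambda x.t\rangle\,u \mapsto L\langle t[x\backslash u]\rangle$; $\mathtt{s!}$: $t[x\backslash L\langle !u\rangle] \mapsto L\langle t\{x\backslash u\}\rangle$; $\mathtt{d!}$: $\mathrm{der}(L\langle !t\rangle)\mapsto L\langle t\rangle$. $\to_{\mathtt w}$ is the closure of the three rules under weak contexts. $t\twoheadrightarrow_{\mathtt w}^{(b,e)}u$ means $t$ $\to_{\mathtt w}$-reduces to $u$ with exactly $b$ $\mathtt{dB}$-steps and $e$ steps of kind $\mathtt{s!}$ or $\mathtt{d!}$. Weakly clash-free normal terms: $\mathsf{ne}_{\mathtt{wcf}}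 ::= x \mid \mathsf{ne}_{\mathtt{wcf}}\,\mathsf{na}_{\mathtt{wcf}} \mid \mathrm{der}(\mathsf{ne}_{\mathtt{wcf}}) \mid \mathsf{ne}_{\mathtt{wcf}}[x\backslash\mathsf{ne}_{\mathtt{wcf}}]$; $\mathsf{na}_{\mathtt{wcf}} ::= {!t} \mid \mathsf{ne}_{\mathtt{wcf}} \mid \mathsf{na}_{\mathtt{wcf}}[x\backslash\mathsf{ne}_{\mathtt{wcf}}]$ ($t$ any term); $\mathsf{nb}_{\mathtt{wcf}} ::= \mathsf{ne}_{\mathtt{wcf}} \mid \lambda x.\mathsf{no}_{\mathtt{wcf}} \mid \mathsf{nb}_{\mathtt{wcf}}[x\backslash\mathsf{ne}_{\mathtt{wcf}}]$; $\mathsf{no}_{\mathtt{wcf}} ::= \mathsf{na}_{\mathtt{wcf}}\mid\mathsf{nb}_{\mathtt{wcf}}$. Size: $|x|_{\mathtt w}=0$, $|!t|_{\mathtt w}=0$, $|t\,u|_{\mathtt w}=1+|t|_{\mathtt w}+|u|_{\mathtt w}$, $|\lambda x.t|_{\mathtt w}=1+|t|_{\mathtt w}$, $|\mathrm{der}\,t|_{\mathtt w}=1+|t|_{\mathtt w}$, $|t[x\backslash u]|_{\mathtt w}=|t|_{\mathtt w}+|u|_{\mathtt w}$. System $\mathcal E$. Tight constants: $\mathtt{tt} ::= \mathtt a\mid\mathtt b\mid\mathtt n$. Types: $\sigma,\tau ::= \mathtt{tt}\mid M\mid M\to\sigma$; multiset types $M ::= [\sigma_i]_{i\in I}$, $I$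 finite, possibly empty. $\overline{\mathtt a}$ stands for any tight constant different from $\mathtt a$ (i.e. $\mathtt b$ or $\mathtt n$). Typing contexts map variables to multiset types, all but finitely many to the empty multiset $[\,]$; $+$ is pointwise multiset union; $\Gamma\setminus\!\!\setminus x$ maps $x$ to $[\,]$ and agrees with $\Gamma$ elsewhere. $M$ is tight, written $\mathsf{tight}(M)$, if all its elements are tight constants; $\Gamma$ is tight if all $\Gamma(x)$ are tight; a derivation of $\Gamma\vdash^{(b,e,s)}t:\sigma$ is tight if $\Gamma$ is tight and $\sigma$ is a tight constant. Counters $b,e,s$ are natural numbers. Persistent rules: $(\mathrm{ae}_p)$ from $\Gamma\vdash^{(b,e,s)}t:\mathtt n$ and $\Delta\vdash^{(b',e',s')}u:\overline{\mathtt a}$ infer $\Gamma+\Delta\vdash^{(b+b',e+e',s+s'+1)}t\,u:\mathtt n$; $(\mathrm{ai}_p)$ from $\Gamma\vdash^{(b,e,s)}t:\mathtt{tt}$ (any tight constant) and $\mathsf{tight}(\Gamma(x))$ infer $\Gamma\setminus\!\!\setminus x\vdash^{(b,e,s+1)}\lambda x.t:\mathtt a$; $(\mathrm{bg}_p)$ $\vdash^{(0,0,0)}{!t}:\mathtt b$ (empty context, any $t$); $(\mathrm{dr}_p)$ from $\Gamma\vdash^{(b,e,s)}t:\mathtt n$ infer $\Gamma\vdash^{(b,e,s+1)}\mathrm{der}\,t:\mathtt n$; $(\mathrm{es}_p)$ from $\Gamma\vdash^{(b,e,s)}t:\tau$, $\Delta\vdash^{(b',e',s')}u:\mathtt n$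 and $\mathsf{tight}(\Gamma(x))$ infer $(\Gamma\setminus\!\!\setminus x)+\Delta\vdash^{(b+b',e+e',s+s')}t[x\backslash u]:\tau$. Consuming rules: $(\mathrm{ax}_c)$ $x:[\sigma]\vdash^{(0,0,0)}x:\sigma$; $(\mathrm{ae}_{c1})$ from $\Gamma\vdash^{(b,e,s)}t:M\to\tau$ and $\Delta\vdash^{(b',e',s')}u:M$ infer $\Gamma+\Delta\vdash^{(b+b'+1,e+e',s+s')}t\,u:\tau$; $(\mathrm{ae}_{c2})$ from $\Gamma\vdash^{(b,e,s)}t:M\to\tau$, $\Delta\vdash^{(b',e',s')}u:\mathtt n$ and $\mathsf{tight}(M)$ infer $\Gamma+\Delta\vdash^{(b+b'+1,e+e',s+s')}t\,u:\tau$; $(\mathrm{ai}_c)$ from $\Gamma\vdash^{(b,e,s)}t:\tau$ infer $\Gamma\setminus\!\!\setminus x\vdash^{(b,e,s)}\lambda x.t:\Gamma(x)\to\tau$; $(\mathrm{bg}_c)$ from $(\Gamma_i\vdash^{(b_i,e_i,s_i)}t:\sigma_i)_{i\in I}$ infer $+_{i\in I}\Gamma_i\vdash^{(\sum_i b_i,\,1+\sum_i e_i,\,\sum_i s_i)}{!t}:[\sigma_i]_{i\in I}$ ($I$ finite, possibly empty); $(\mathrm{dr}_c)$ from $\Gamma\vdash^{(b,e,s)}t:[\sigma]$ infer $\Gamma\vdash^{(b,e,s)}\mathrm{der}\,t:\sigma$; $(\mathrm{es}_c)$ from $\Gamma\vdash^{(b,e,s)}t:\sigma$ and $\Delta\vdash^{(b',e',s')}u:\Gamma(x)$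 infer $(\Gamma\setminus\!\!\setminus x)+\Delta\vdash^{(b+b',e+e',s+s')}t[x\backslash u]:\sigma$. -}

module Defs where

open import Data.Fin.Base using (Fin; zero; suc)
open import Data.List.Base using (List; []; _∷_; _++_)
open import Data.List.Relation.Binary.Permutation.Homogeneous using (Permutation)
import Data.List.Relation.Unary.All as List
open import Data.Nat.Base using (ℕ; zero; suc; _+_)
open import Data.Product.Base using (_×_)
open import Data.Vec.Base using (Vec; []; _∷_; replicate; zipWith; _[_]≔_)
open import Data.Vec.Relation.Binary.Pointwise.Inductive using (Pointwise)
import Data.Vec.Relation.Unary.All as Vec
open import Function.Base using (id; _∘_)
open import Relation.Binary.PropositionalEquality.Core using (_≢_)

infix  10 !_ der_ ƛ_
infixl 11 _·_
infixl 12 _[∖_]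

-- Terms modulo α-conversion, as well-scoped de Bruijn terms: `Term n` has its
-- free variables among n variables.  `t [∖ u ]` is the explicit substitution
-- t[x\u]; x is variable `zero` of t and does not scope over u.

data Term (n : ℕ) : Set where
  var    : Fin n → Term n
  _·_    : Term n → Term n → Term n
  ƛ_     : Term (suc n) → Term n
  !_     : Term n → Term n
  der_   : Term n → Term n
  _[∖_]  : Term (suc n) → Term n → Term n

private
  variable
    n m : ℕ

ext : (Fin n → Fin m) → Fin (suc n) → Fin (suc m)
ext ρ zero    = zero
ext ρ (suc x) = suc (ρ x)

rename : (Fin n → Fin m) → Term n → Term m
rename ρ (var x)    = var (ρ x)
rename ρ (t · u)    = rename ρ t · rename ρ u
rename ρ (ƛ t)      = ƛ rename (ext ρ) t
rename ρ (! t)      = ! rename ρ t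
rename ρ (der t)    = der rename ρ t
rename ρ (t [∖ u ]) = rename (ext ρ) t [∖ rename ρ u ]

extˢ : (Fin n → Term m) → Fin (suc n) → Term (suc m)
extˢ θ zero    = var zero
extˢ θ (suc x) = rename suc (θ x)

sub : (Fin n → Term m) → Term n → Term m
sub θ (var x)    = θ x
sub θ (t · u)    = sub θ t · sub θ u
sub θ (ƛ t)      = ƛ sub (extˢ θ) t
sub θ (! t)      = ! sub θ t
sub θ (der t)    = der sub θ t
sub θ (t [∖ u ]) = sub (extˢ θ) t [∖ sub θ u ]

single : Term n → Fin (suc n) → Term n
single u zero    = u
single u (suc x) = var x

-- Meta-level substitution t{x\u}, for x the variable `zero` of t.
infixl 12 _⟪_⟫
_⟪_⟫ : Term (suc n) → Term n → Term n
t ⟪ u ⟫ = sub (single u) t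

-- In `LCtx n m` and `WCtx n m`, n is the scope of the whole context and m the
-- scope at the hole: plugging captures the m ∸ n variables bound on the way.

data LCtx (n : ℕ) : ℕ → Set where
  □     : LCtx n n
  _[∖_] : LCtx (suc n) m → Term n → LCtx n m

infix 9 _L⟨_⟩ _W⟨_⟩

_L⟨_⟩ : LCtx n m → Term m → Term n
□ L⟨ t ⟩          = t
(L [∖ u ]) L⟨ t ⟩ = (L L⟨ t ⟩) [∖ u ]

-- The embedding of the outer scope into the scope of the hole.  Renaming along
-- it is what makes moving a term under L capture-avoiding.
under : LCtx n m → Fin n → Fin m
under □          = id
under (L [∖ _ ]) = under L ∘ suc

data WCtx (n : ℕ) : ℕ → Set where
  □      : WCtx n n
  _·ˡ_   : WCtx n m → Term n → WCtx n m
  _·ʳ_   : Term n → WCtx n m → WCtx n m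
  ƛ_     : WCtx (suc n) m → WCtx n m
  der_   : WCtx n m → WCtx n m
  _[∖_]ˡ : WCtx (suc n) m → Term n → WCtx n m
  _[∖_]ʳ : Term (suc n) → WCtx n m → WCtx n m

_W⟨_⟩ : WCtx n m → Term m → Term n
□ W⟨ t ⟩           = t
(W ·ˡ u) W⟨ t ⟩    = (W W⟨ t ⟩) · u
(u ·ʳ W) W⟨ t ⟩    = u · (W W⟨ t ⟩)
(ƛ W) W⟨ t ⟩       = ƛ (W W⟨ t ⟩)
(der W) W⟨ t ⟩     = der (W W⟨ t ⟩)
(W [∖ u ]ˡ) W⟨ t ⟩ = (W W⟨ t ⟩) [∖ u ]
(u [∖ W ]ʳ) W⟨ t ⟩ = u [∖ W W⟨ t ⟩ ]

data Rule : Set where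
  dB s! d! : Rule

infix 4 _↦⟨_⟩_ _→w⟨_⟩_ _↠w⟨_,_⟩_

data _↦⟨_⟩_ {n : ℕ} : Term n → Rule → Term n → Set where
  dB : (L : LCtx n m) (t : Term (suc m)) (u : Term n) →
       (L L⟨ ƛ t ⟩) · u ↦⟨ dB ⟩ L L⟨ t [∖ rename (under L) u ] ⟩
  s! : (L : LCtx n m) (t : Term (suc n)) (u : Term m) →
       t [∖ L L⟨ ! u ⟩ ] ↦⟨ s! ⟩ L L⟨ rename (ext (under L)) t ⟪ u ⟫ ⟩
  d! : (L : LCtx n m) (t : Term m) →
       der (L L⟨ ! t ⟩) ↦⟨ d! ⟩ L L⟨ t ⟩

data _→w⟨_⟩_ {n : ℕ} : Term n → Rule → Term n → Set where
  closure : ∀ {r} (W : WCtx n m) {t u : Term m} →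
            t ↦⟨ r ⟩ u → W W⟨ t ⟩ →w⟨ r ⟩ W W⟨ u ⟩

data _↠w⟨_,_⟩_ {n : ℕ} : Term n → ℕ → ℕ → Term n → Set where
  done    : ∀ {t} → t ↠w⟨ 0 , 0 ⟩ t
  step-dB : ∀ {t u p b e} → t →w⟨ dB ⟩ u → u ↠w⟨ b , e ⟩ p → t ↠w⟨ suc b , e ⟩ p
  step-s! : ∀ {t u p b e} → t →w⟨ s! ⟩ u → u ↠w⟨ b , e ⟩ p → t ↠w⟨ b , suc e ⟩ p
  step-d! : ∀ {t u p b e} → t →w⟨ d! ⟩ u → u ↠w⟨ b , e ⟩ p → t ↠w⟨ b , suc e ⟩ p

-- Weakly clash-free normal terms.

mutual
  data Ne {n : ℕ} : Term n → Set where
    var   : ∀ x → Ne (var x)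
    _·_   : ∀ {t u} → Ne t → Na u → Ne (t · u)
    der_  : ∀ {t} → Ne t → Ne (der t)
    _[∖_] : ∀ {t u} → Ne t → Ne u → Ne (t [∖ u ])

  data Na {n : ℕ} : Term n → Set where
    !_    : ∀ t → Na (! t)
    ne    : ∀ {t} → Ne t → Na t
    _[∖_] : ∀ {t u} → Na t → Ne u → Na (t [∖ u ])

data Nb {n : ℕ} : Term n → Set
data No {n : ℕ} : Term n → Set

data Nb {n} where
  ne    : ∀ {t} → Ne t → Nb t
  ƛ_    : ∀ {t} → No t → Nb (ƛ t)
  _[∖_] : ∀ {t u} → Nb t → Ne u → Nb (t [∖ u ])

data No {n} where
  na : ∀ {t} → Na t → No t
  nb : ∀ {t} → Nb t → No t

∣_∣w : Term n → ℕ
∣ var x ∣w    = 0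
∣ t · u ∣w    = 1 + ∣ t ∣w + ∣ u ∣w
∣ ƛ t ∣w      = 1 + ∣ t ∣w
∣ ! t ∣w      = 0
∣ der t ∣w    = 1 + ∣ t ∣w
∣ t [∖ u ] ∣w = ∣ t ∣w + ∣ u ∣w

data TightConstant : Set where
  𝚊 𝚋 𝚗 : TightConstant

-- A multiset type is represented by a list of types.  Types are considered up
-- to _≈_, which identifies lists that are permutations of each other at every
-- nesting depth; rule `conv` below makes typing insensitive to the choice of
-- representative.

infixr 6 _⇒_

data Type : Set where
  tt  : TightConstant → Type
  ms  : List Type → Type
  _⇒_ : List Type → Type → Type

MType : Set
MType = List Type

infix 4 _≈_ _≈ₘ_ _≈ᶜ_

data _≈_ : Type → Type → Set where
  tt  : ∀ c → tt c ≈ tt c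
  ms  : ∀ {M N} → Permutation _≈_ M N → ms M ≈ ms N
  _⇒_ : ∀ {M N σ τ} → Permutation _≈_ M N → σ ≈ τ → M ⇒ σ ≈ N ⇒ τ

_≈ₘ_ : MType → MType → Set
_≈ₘ_ = Permutation _≈_

-- Typing contexts for terms in scope n.  For Γ = M ∷ Γ′, M is Γ(x) and Γ′ is
-- Γ∖∖x, where x is the variable `zero`.
Ctx : ℕ → Set
Ctx n = Vec MType n

∅ : Ctx n
∅ = replicate _ []

infix 8 _∶[_]
_∶[_] : Fin n → Type → Ctx n
x ∶[ σ ] = ∅ [ x ]≔ (σ ∷ [])

infixl 7 _⊕_
_⊕_ : Ctx n → Ctx n → Ctx n
_⊕_ = zipWith _++_

_≈ᶜ_ : Ctx n → Ctx n → Set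
_≈ᶜ_ = Pointwise _≈ₘ_

data IsTight : Type → Set where
  tt : ∀ c → IsTight (tt c)

Tightₘ : MType → Set
Tightₘ = List.All IsTight

Tightᶜ : Ctx n → Set
Tightᶜ = Vec.All Tightₘ

infix 4 _⊢⟨_,_,_⟩_∶_ _⊢*⟨_,_,_⟩_∶_

data _⊢⟨_,_,_⟩_∶_ {n : ℕ} : Ctx n → ℕ → ℕ → ℕ → Term n → Type → Set

-- Finite families (Γᵢ ⊢⟨ bᵢ , eᵢ , sᵢ ⟩ t ∶ σᵢ)ᵢ of derivations for one term t,
-- indexed by the sums of the contexts and counters and by the list of the σᵢ.
data _⊢*⟨_,_,_⟩_∶_ {n : ℕ} : Ctx n → ℕ → ℕ → ℕ → Term n → MType → Set where
  []  : ∀ {t} → ∅ ⊢*⟨ 0 , 0 , 0 ⟩ t ∶ []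
  _∷_ : ∀ {Γ Δ b b′ e e′ s s′ t σ M} →
        Γ ⊢⟨ b , e , s ⟩ t ∶ σ →
        Δ ⊢*⟨ b′ , e′ , s′ ⟩ t ∶ M →
        Γ ⊕ Δ ⊢*⟨ b + b′ , e + e′ , s + s′ ⟩ t ∶ σ ∷ M

data _⊢⟨_,_,_⟩_∶_ {n} where
  aeₚ  : ∀ {Γ Δ b b′ e e′ s s′ t u c} →
         Γ ⊢⟨ b , e , s ⟩ t ∶ tt 𝚗 →
         Δ ⊢⟨ b′ , e′ , s′ ⟩ u ∶ tt c → c ≢ 𝚊 →
         Γ ⊕ Δ ⊢⟨ b + b′ , e + e′ , s + s′ + 1 ⟩ t · u ∶ tt 𝚗

  aiₚ  : ∀ {Γ M b e s t c} →
         M ∷ Γ ⊢⟨ b , e , s ⟩ t ∶ tt c → Tightₘ M →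
         Γ ⊢⟨ b , e , s + 1 ⟩ ƛ t ∶ tt 𝚊

  bgₚ  : ∀ {t} →
         ∅ ⊢⟨ 0 , 0 , 0 ⟩ ! t ∶ tt 𝚋

  drₚ  : ∀ {Γ b e s t} →
         Γ ⊢⟨ b , e , s ⟩ t ∶ tt 𝚗 →
         Γ ⊢⟨ b , e , s + 1 ⟩ der t ∶ tt 𝚗

  esₚ  : ∀ {Γ Δ M b b′ e e′ s s′ t u τ} →
         M ∷ Γ ⊢⟨ b , e , s ⟩ t ∶ τ →
         Δ ⊢⟨ b′ , e′ , s′ ⟩ u ∶ tt 𝚗 → Tightₘ M →
         Γ ⊕ Δ ⊢⟨ b + b′ , e + e′ , s + s′ ⟩ t [∖ u ] ∶ τ

  ax   : ∀ x {σ} →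
         x ∶[ σ ] ⊢⟨ 0 , 0 , 0 ⟩ var x ∶ σ

  ae₁  : ∀ {Γ Δ M b b′ e e′ s s′ t u τ} →
         Γ ⊢⟨ b , e , s ⟩ t ∶ M ⇒ τ →
         Δ ⊢⟨ b′ , e′ , s′ ⟩ u ∶ ms M →
         Γ ⊕ Δ ⊢⟨ b + b′ + 1 , e + e′ , s + s′ ⟩ t · u ∶ τ

  ae₂  : ∀ {Γ Δ M b b′ e e′ s s′ t u τ} →
         Γ ⊢⟨ b , e , s ⟩ t ∶ M ⇒ τ →
         Δ ⊢⟨ b′ , e′ , s′ ⟩ u ∶ tt 𝚗 → Tightₘ M →
         Γ ⊕ Δ ⊢⟨ b + b′ + 1 , e + e′ , s + s′ ⟩ t · u ∶ τ

  ai   : ∀ {Γ M b e s t τ} →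
         M ∷ Γ ⊢⟨ b , e , s ⟩ t ∶ τ →
         Γ ⊢⟨ b , e , s ⟩ ƛ t ∶ M ⇒ τ

  bg   : ∀ {Γ M b e s t} →
         Γ ⊢*⟨ b , e , s ⟩ t ∶ M →
         Γ ⊢⟨ b , 1 + e , s ⟩ ! t ∶ ms M

  dr   : ∀ {Γ b e s t σ} →
         Γ ⊢⟨ b , e , s ⟩ t ∶ ms (σ ∷ []) →
         Γ ⊢⟨ b , e , s ⟩ der t ∶ σ

  es   : ∀ {Γ Δ M b b′ e e′ s s′ t u σ} →
         M ∷ Γ ⊢⟨ b , e , s ⟩ t ∶ σ →
         Δ ⊢⟨ b′ , e′ , s′ ⟩ u ∶ ms M →
         Γ ⊕ Δ ⊢⟨ b + b′ , e + e′ , s + s′ ⟩ t [∖ u ] ∶ σ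

  -- Not a rule on types proper: it only changes list representatives.
  conv : ∀ {Γ Γ′ b e s t σ σ′} →
         Γ ⊢⟨ b , e , s ⟩ t ∶ σ → Γ ≈ᶜ Γ′ → σ ≈ σ′ →
         Γ′ ⊢⟨ b , e , s ⟩ t ∶ σ′

TightDerivation : ∀ {Γ : Ctx n} {b e s t σ} → Γ ⊢⟨ b , e , s ⟩ t ∶ σ → Set
TightDerivation {Γ = Γ} {σ = σ} _ = Tightᶜ Γ × IsTight σ

{-# OPTIONS --safe #-}
module Submission where

-- Weakly clash-free normal forms are tightly typable with counters (0 , 0 , |p|),
-- and typing is preserved backwards by every step at the price of one unit of b
-- or e.  The crux is anti-substitution: a derivation for t{x\u} splits into one
-- for t, in which x gets a multiset M, and one for u for each element of M; the
-- latter are what rule bg needs to type !u with M.  A weak context never puts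
-- its hole under a !, so the redex is typed exactly once and the cost is exact.

open import Defs
open import Algebra.Bundles using (CommutativeMonoid)
import Algebra.Properties.CommutativeSemigroup as CommutativeSemigroupProperties
open import Data.Fin.Base using (Fin; zero; suc)
open import Data.List.Base using ([]; _∷_; _++_)
open import Data.List.Relation.Binary.Pointwise.Base as List using ([]; _∷_)
open import Data.List.Relation.Binary.Permutation.Homogeneous
  using (refl; prep; swap; trans)
open import Data.List.Relation.Binary.Permutation.Propositional
  using (_↭_; refl; prep; swap; trans; ↭-sym; ↭-trans)
open import Data.List.Relation.Binary.Permutation.Propositional.Properties
  using (++⁺; ++-assoc; ++-comm; ++-identityʳ)
open import Data.List.Relation.Unary.All using ([]; _∷_)
import Data.List.Relation.Unary.All.Properties as All
open import Data.Nat.Base using (ℕ; zero; suc; _+_)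
import Data.Nat.Properties as ℕ
open import Data.Product.Base using (Σ-syntax; ∃-syntax; _×_; _,_)
open import Data.Vec.Base using ([]; _∷_; _[_]≔_)
open import Data.Vec.Relation.Binary.Pointwise.Inductive using (Pointwise; []; _∷_)
import Data.Vec.Relation.Binary.Pointwise.Inductive as Pointwise
open import Data.Vec.Relation.Unary.All using ([]; _∷_)
open import Function.Base using (id; _∘_)
open import Level using (0ℓ)
open import Relation.Binary.PropositionalEquality
  using (_≡_; _≢_; refl; cong; cong₂)
import Relation.Binary.PropositionalEquality as ≡
import Relation.Binary.Reasoning.Setoid as SetoidReasoning

private
  variable
    n m : ℕ
    M N : MType
    Γ Δ : Ctx n
    σ τ ρ : Type

-- Resources

infix 4 _↭ᶜ_

_↭ᶜ_ : Ctx n → Ctx n → Set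
_↭ᶜ_ = Pointwise _↭_

↭ᶜ-refl : Γ ↭ᶜ Γ
↭ᶜ-refl = Pointwise.refl refl

⊕-cong : {Γ Γ′ Δ Δ′ : Ctx n} → Γ ↭ᶜ Γ′ → Δ ↭ᶜ Δ′ → Γ ⊕ Δ ↭ᶜ Γ′ ⊕ Δ′
⊕-cong []       []       = []
⊕-cong (p ∷ ps) (q ∷ qs) = ++⁺ p q ∷ ⊕-cong ps qs

⊕-assoc : (Γ Δ Θ : Ctx n) → (Γ ⊕ Δ) ⊕ Θ ↭ᶜ Γ ⊕ (Δ ⊕ Θ)
⊕-assoc []      []      []      = []
⊕-assoc (M ∷ Γ) (N ∷ Δ) (O ∷ Θ) = ++-assoc M N O ∷ ⊕-assoc Γ Δ Θ

⊕-identityˡ : (Γ : Ctx n) → ∅ ⊕ Γ ↭ᶜ Γ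
⊕-identityˡ []      = []
⊕-identityˡ (M ∷ Γ) = refl ∷ ⊕-identityˡ Γ

⊕-comm : (Γ Δ : Ctx n) → Γ ⊕ Δ ↭ᶜ Δ ⊕ Γ
⊕-comm []      []      = []
⊕-comm (M ∷ Γ) (N ∷ Δ) = ++-comm M N ∷ ⊕-comm Γ Δ

Counters : Set
Counters = ℕ × ℕ × ℕ

infixl 6 _+ᶜ_

-- Opaque, so that unification can read k and k′ off k +ᶜ k′.
opaque
  _+ᶜ_ : Counters → Counters → Counters
  (b , e , s) +ᶜ (b′ , e′ , s′) = b + b′ , e + e′ , s + s′

  +ᶜ-assoc : ∀ k k′ k″ → (k +ᶜ k′) +ᶜ k″ ≡ k +ᶜ (k′ +ᶜ k″)
  +ᶜ-assoc (b , e , s) (b′ , e′ , s′) (b″ , e″ , s″) =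
    cong₂ _,_ (ℕ.+-assoc b b′ b″) (cong₂ _,_ (ℕ.+-assoc e e′ e″) (ℕ.+-assoc s s′ s″))

  +ᶜ-comm : ∀ k k′ → k +ᶜ k′ ≡ k′ +ᶜ k
  +ᶜ-comm (b , e , s) (b′ , e′ , s′) =
    cong₂ _,_ (ℕ.+-comm b b′) (cong₂ _,_ (ℕ.+-comm e e′) (ℕ.+-comm s s′))

  +ᶜ-identityˡ : ∀ k → (0 , 0 , 0) +ᶜ k ≡ k
  +ᶜ-identityˡ k = refl

0ᶜ 1ᵇ 1ᵉ 1ˢ : Counters
0ᶜ = 0 , 0 , 0
1ᵇ = 1 , 0 , 0
1ᵉ = 0 , 1 , 0
1ˢ = 0 , 0 , 1

-- Context and counters travel together, so that the bookkeeping of every transformation of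
-- derivations becomes reasoning in one commutative monoid.
record Res (n : ℕ) : Set where
  constructor _▹_
  field
    ctx : Ctx n
    cnt : Counters

open Res

infix 4.5 _▹_
infix 4 _≋_
infixl 7 _⊞_
infixr 8 _◂_

record _≋_ (r q : Res n) : Set where
  constructor _,_
  field
    ctx≋ : ctx r ↭ᶜ ctx q
    cnt≋ : cnt r ≡ cnt q

_⊞_ : Res n → Res n → Res n
r ⊞ q = ctx r ⊕ ctx q ▹ cnt r +ᶜ cnt q

_◂_ : MType → Res n → Res (suc n)
M ◂ r = M ∷ ctx r ▹ cnt r

tick : Counters → Res n
tick k = ∅ ▹ k

resources : ℕ → CommutativeMonoid 0ℓ 0ℓ
resources n = record
  { Carrier = Res n ; _≈_ = _≋_ ; _∙_ = _⊞_ ; ε = tick 0ᶜ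
  ; isCommutativeMonoid = record
    { isMonoid = record
      { isSemigroup = record
        { isMagma = record
          { isEquivalence = record
            { refl  = ↭ᶜ-refl , refl
            ; sym   = λ (p , e) → Pointwise.sym ↭-sym p , ≡.sym e
            ; trans = ≋-trans
            }
          ; ∙-cong = λ (p , e) (p′ , e′) → ⊕-cong p p′ , cong₂ _+ᶜ_ e e′
          }
        ; assoc = λ (Γ ▹ k) (Γ′ ▹ k′) (Γ″ ▹ k″) → ⊕-assoc Γ Γ′ Γ″ , +ᶜ-assoc k k′ k″
        }
      ; identity = identityˡ , λ r → ≋-trans (comm r (tick 0ᶜ)) (identityˡ r)
      }
    ; comm = comm
    }
  }
  where
  ≋-trans : {r q o : Res n} → r ≋ q → q ≋ o → r ≋ o
  ≋-trans (p , e) (p′ , e′) = Pointwise.trans ↭-trans p p′ , ≡.trans e e′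
  identityˡ : (r : Res n) → tick 0ᶜ ⊞ r ≋ r
  identityˡ r = ⊕-identityˡ (ctx r) , +ᶜ-identityˡ (cnt r)
  comm : (r q : Res n) → r ⊞ q ≋ q ⊞ r
  comm r q = ⊕-comm (ctx r) (ctx q) , +ᶜ-comm (cnt r) (cnt q)

open _≋_

module ≋ {n : ℕ} where
  open CommutativeMonoid (resources n) public
  open CommutativeSemigroupProperties commutativeSemigroup public
  open SetoidReasoning setoid public

private
  variable
    r q r₁ r₂ q₁ q₂ : Res n
    k : Counters

◂-cong : M ↭ N → r ≋ q → M ◂ r ≋ N ◂ q
◂-cong p (ps , e) = p ∷ ps , e

◂-uncong : M ◂ r ≋ N ◂ q → (M ↭ N) × (r ≋ q)
◂-uncong (p ∷ ps , e) = p , (ps , e)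

-- Pushing a resource forward along a renaming

-- An image measure: at `y` it sums the multisets that the context has at all `x` with `f x` equal
-- to `y`.
pushᶜ : (Fin n → Fin m) → Ctx n → Ctx m
pushᶜ f []      = ∅
pushᶜ f (M ∷ Γ) = (∅ [ f zero ]≔ M) ⊕ pushᶜ (f ∘ suc) Γ

push : (Fin n → Fin m) → Res n → Res m
push f r = pushᶜ f (ctx r) ▹ cnt r

_↦_ : Fin n → MType → Res n
x ↦ M = ∅ [ x ]≔ M ▹ 0ᶜ

↦-[] : (x : Fin n) → x ↦ [] ≋ tick 0ᶜ
↦-[] zero    = ≋.refl
↦-[] (suc x) = ◂-cong refl (↦-[] x)

↦-++ : (x : Fin n) → x ↦ (M ++ N) ≋ (x ↦ M) ⊞ (x ↦ N)
↦-++ zero    = ◂-cong refl (≋.sym (≋.identityˡ (tick 0ᶜ)))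
↦-++ (suc x) = ◂-cong refl (↦-++ x)

tick-+ : ∀ k k′ → tick {n} (k +ᶜ k′) ≋ tick k ⊞ tick k′
tick-+ k k′ = Pointwise.sym ↭-sym (⊕-identityˡ ∅) , refl

push-◂ : (f : Fin (suc n) → Fin m) (r : Res n) →
         push f (M ◂ r) ≋ (f zero ↦ M) ⊞ push (f ∘ suc) r
push-◂ f r = ↭ᶜ-refl , ≡.sym (+ᶜ-identityˡ (cnt r))

push-weaken : (f : Fin (suc n) → Fin m) (r : Res n) →
              push (f ∘ suc) r ≋ push f ([] ◂ r)
push-weaken f r =
  ≋.sym (≋.trans (push-◂ f r) (≋.trans (≋.∙-congʳ (↦-[] (f zero))) (≋.identityˡ _)))

push-⊞ : (f : Fin n → Fin m) (r q : Res n) → push f (r ⊞ q) ≋ push f r ⊞ push f q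
push-⊞ f ([] ▹ k) ([] ▹ k′) = tick-+ k k′
push-⊞ f (M ∷ Γ ▹ k) (N ∷ Δ ▹ k′) = ≋.begin
  push f ((M ++ N) ◂ (r′ ⊞ q′))
    ≋.≈⟨ push-◂ f (r′ ⊞ q′) ⟩
  (f zero ↦ (M ++ N)) ⊞ push (f ∘ suc) (r′ ⊞ q′)
    ≋.≈⟨ ≋.∙-cong (↦-++ (f zero)) (push-⊞ (f ∘ suc) r′ q′) ⟩
  ((f zero ↦ M) ⊞ (f zero ↦ N)) ⊞ (push (f ∘ suc) r′ ⊞ push (f ∘ suc) q′)
    ≋.≈⟨ ≋.interchange (f zero ↦ M) (f zero ↦ N) _ _ ⟩
  ((f zero ↦ M) ⊞ push (f ∘ suc) r′) ⊞ ((f zero ↦ N) ⊞ push (f ∘ suc) q′)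
    ≋.≈⟨ ≋.∙-cong (push-◂ f r′) (push-◂ f q′) ⟨
  push f (M ◂ r′) ⊞ push f (N ◂ q′) ≋.∎
  where
  r′ = Γ ▹ k
  q′ = Δ ▹ k′

push-tick : (f : Fin n → Fin m) (k : Counters) → push f (tick k) ≋ tick k
push-tick {zero}  f k = ≋.refl
push-tick {suc n} f k = ≋.trans (≋.sym (push-weaken f (tick k))) (push-tick (f ∘ suc) k)

push-↦ : (f : Fin n → Fin m) (x : Fin n) → push f (x ↦ M) ≋ f x ↦ M
push-↦ f zero =
  ≋.trans (push-◂ f (tick 0ᶜ))
          (≋.trans (≋.∙-congˡ (push-tick (f ∘ suc) 0ᶜ)) (≋.identityʳ _))
push-↦ {M = M} f (suc x) =
  ≋.trans (≋.sym (push-weaken f (x ↦ M))) (push-↦ (f ∘ suc) x)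

pushᶜ-suc : (f : Fin n → Fin m) (Γ : Ctx n) → pushᶜ (suc ∘ f) Γ ≡ [] ∷ pushᶜ f Γ
pushᶜ-suc f []      = refl
pushᶜ-suc f (M ∷ Γ) = cong ((∅ [ suc (f zero) ]≔ M) ⊕_) (pushᶜ-suc (f ∘ suc) Γ)

push-ext : (f : Fin n → Fin m) (r : Res n) → push (ext f) (M ◂ r) ≋ M ◂ push f r
push-ext {M = M} f (Γ ▹ k) rewrite pushᶜ-suc f Γ =
  (++-identityʳ M ∷ ⊕-identityˡ _) , refl

push-id : (r : Res n) → push id r ≋ r
push-id ([] ▹ k)    = ≋.refl
push-id (M ∷ Γ ▹ k) rewrite pushᶜ-suc id Γ =
  (++-identityʳ M ∷ Pointwise.trans ↭-trans (⊕-identityˡ _) (ctx≋ (push-id (Γ ▹ k)))) , refl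

push-suc : (r : Res n) → push suc r ≋ [] ◂ r
push-suc r@(Γ ▹ k) rewrite pushᶜ-suc id Γ = ◂-cong refl (push-id r)

-- A presentation of system 𝓔 without `conv`: only contexts are taken up to
-- permutation, which suffices for subject expansion.  The rules for one term
-- former are merged into one constructor, since their differences (the types
-- involved and the counters spent, collected in AppRule etc.) play no role when
-- traversing substitutions, renamings and weak contexts.

data AppRule : Type → Type → Counters → Type → Set where
  aeₚ : ∀ {c} → c ≢ 𝚊 → AppRule (tt 𝚗) (tt c) 1ˢ (tt 𝚗)
  ae₁ : AppRule (M ⇒ τ) (ms M) 1ᵇ τ
  ae₂ : Tightₘ M → AppRule (M ⇒ τ) (tt 𝚗) 1ᵇ τ

data LamRule : MType → Type → Counters → Type → Set where
  aiₚ : ∀ {c} → Tightₘ M → LamRule M (tt c) 1ˢ (tt 𝚊)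
  ai  : LamRule M τ 0ᶜ (M ⇒ τ)

-- The premise-free persistent rule is given the empty family, so that it fits the same constructor
-- `bang`.
data BangRule : MType → Counters → Type → Set where
  bgₚ : BangRule [] 0ᶜ (tt 𝚋)
  bg  : BangRule M 1ᵉ (ms M)

data DerRule : Type → Counters → Type → Set where
  drₚ : DerRule (tt 𝚗) 1ˢ (tt 𝚗)
  dr  : DerRule (ms (σ ∷ [])) 0ᶜ σ

data CutRule : MType → Type → Set where
  esₚ : Tightₘ M → CutRule M (tt 𝚗)
  es  : CutRule M (ms M)

infix 4 _⊩_∶_ _⊩*_∶_

mutual
  -- The resource is a parameter constrained by an equation in each constructor: matching never has
  -- to unify it with a sum, and `⊩-resp` needs no induction.
  data _⊩_∶_ {n : ℕ} (r : Res n) : Term n → Type → Set where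
    var : ∀ {x} → x ↦ (σ ∷ []) ≋ r → r ⊩ var x ∶ σ
    app : ∀ {t u} → AppRule σ ρ k τ → r₁ ⊩ t ∶ σ → r₂ ⊩ u ∶ ρ →
          tick k ⊞ (r₁ ⊞ r₂) ≋ r → r ⊩ t · u ∶ τ
    lam : ∀ {t} → LamRule M σ k τ → M ◂ r₁ ⊩ t ∶ σ → tick k ⊞ r₁ ≋ r → r ⊩ ƛ t ∶ τ
    bang : ∀ {t} → BangRule M k τ → r₁ ⊩* t ∶ M → tick k ⊞ r₁ ≋ r → r ⊩ ! t ∶ τ
    derel : ∀ {t} → DerRule σ k τ → r₁ ⊩ t ∶ σ → tick k ⊞ r₁ ≋ r → r ⊩ der t ∶ τ
    cut : ∀ {t u} → CutRule M ρ → M ◂ r₁ ⊩ t ∶ σ → r₂ ⊩ u ∶ ρ →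
          r₁ ⊞ r₂ ≋ r → r ⊩ t [∖ u ] ∶ σ

  data _⊩*_∶_ {n : ℕ} (r : Res n) (t : Term n) : MType → Set where
    nil  : tick 0ᶜ ≋ r → r ⊩* t ∶ []
    cons : r₁ ⊩ t ∶ σ → r₂ ⊩* t ∶ M → r₁ ⊞ r₂ ≋ r → r ⊩* t ∶ σ ∷ M

⊩-resp : ∀ {t} → r ≋ q → r ⊩ t ∶ σ → q ⊩ t ∶ σ
⊩-resp r≋q (var eq)         = var (≋.trans eq r≋q)
⊩-resp r≋q (app R Φ Ψ eq)   = app R Φ Ψ (≋.trans eq r≋q)
⊩-resp r≋q (lam R Φ eq)     = lam R Φ (≋.trans eq r≋q)
⊩-resp r≋q (bang R Φ eq)    = bang R Φ (≋.trans eq r≋q)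
⊩-resp r≋q (derel R Φ eq)   = derel R Φ (≋.trans eq r≋q)
⊩-resp r≋q (cut R Φ Ψ eq)   = cut R Φ Ψ (≋.trans eq r≋q)

⊩*-resp : ∀ {t} → r ≋ q → r ⊩* t ∶ M → q ⊩* t ∶ M
⊩*-resp r≋q (nil eq)      = nil (≋.trans eq r≋q)
⊩*-resp r≋q (cons Φ Ψ eq) = cons Φ Ψ (≋.trans eq r≋q)

⊩*-++ : ∀ {t} → r ⊩* t ∶ M → q ⊩* t ∶ N → r ⊞ q ⊩* t ∶ M ++ N
⊩*-++ (nil eq) Ψ = ⊩*-resp (≋.trans (≋.sym (≋.identityˡ _)) (≋.∙-congʳ eq)) Ψ
⊩*-++ (cons Φ Φs eq) Ψ =
  cons Φ (⊩*-++ Φs Ψ) (≋.trans (≋.sym (≋.assoc _ _ _)) (≋.∙-congʳ eq))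

-- Only axioms type a variable, so each member of the family asks `x` for its own type and spends no
-- counter.
⊩*-var : ∀ {x} → r ⊩* var x ∶ M → x ↦ M ≋ r
⊩*-var (nil eq) = ≋.trans (↦-[] _) eq
⊩*-var (cons (var eq₁) Φs eq) =
  ≋.trans (↦-++ _) (≋.trans (≋.∙-cong eq₁ (⊩*-var Φs)) eq)

-- Anti-renaming

push-tick-⊞ : (f : Fin n → Fin m) (q : Res n) → push f q ≋ r →
              push f (tick k ⊞ q) ≋ tick k ⊞ r
push-tick-⊞ {k = k} f q eq =
  ≋.trans (push-⊞ f (tick k) q) (≋.∙-cong (push-tick f k) eq)

mutual
  -- The rules are insensitive to names. When `f` merges variables, the axioms at the leaves of `t`
  -- decide how a multiset of `r` is shared among the preimages.
  antirename : (f : Fin n → Fin m) (t : Term n) → r ⊩ rename f t ∶ σ →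
               ∃[ q ] q ⊩ t ∶ σ × push f q ≋ r
  antirename f (var x) (var eq) = _ , var ≋.refl , ≋.trans (push-↦ f x) eq
  antirename f (t · u) (app {k = k} R Φ Ψ eq) =
    let q₁ , Φ′ , eq₁ = antirename f t Φ
        q₂ , Ψ′ , eq₂ = antirename f u Ψ
    in _ , app R Φ′ Ψ′ ≋.refl ,
       ≋.trans (push-tick-⊞ {k = k} f _ (≋.trans (push-⊞ f q₁ q₂) (≋.∙-cong eq₁ eq₂))) eq
  antirename f (ƛ t) (lam R Φ eq) =
    let q , Φ′ , eq₁ = antirename-ext f t Φ
    in _ , lam R Φ′ ≋.refl , ≋.trans (push-tick-⊞ f q eq₁) eq
  antirename f (! t) (bang R Φ eq) =
    let q , Φ′ , eq₁ = antirename* f t Φ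
    in _ , bang R Φ′ ≋.refl , ≋.trans (push-tick-⊞ f q eq₁) eq
  antirename f (der t) (derel R Φ eq) =
    let q , Φ′ , eq₁ = antirename f t Φ
    in _ , derel R Φ′ ≋.refl , ≋.trans (push-tick-⊞ f q eq₁) eq
  antirename f (t [∖ u ]) (cut R Φ Ψ eq) =
    let q₁ , Φ′ , eq₁ = antirename-ext f t Φ
        q₂ , Ψ′ , eq₂ = antirename f u Ψ
    in _ , cut R Φ′ Ψ′ ≋.refl ,
       ≋.trans (push-⊞ f q₁ q₂) (≋.trans (≋.∙-cong eq₁ eq₂) eq)

  antirename-ext : (f : Fin n → Fin m) (t : Term (suc n)) →
                   M ◂ r ⊩ rename (ext f) t ∶ σ →
                   ∃[ q ] M ◂ q ⊩ t ∶ σ × push f q ≋ r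
  antirename-ext f t Φ with antirename (ext f) t Φ
  ... | N ∷ Δ ▹ k , Ψ , eq =
    -- The rule at the binder mentions the list `M` itself, so its permutation `N` must be put back
    -- in that order.
    let N↭M , eq′ = ◂-uncong (≋.trans (≋.sym (push-ext f (Δ ▹ k))) eq)
    in (Δ ▹ k) , ⊩-resp (◂-cong N↭M ≋.refl) Ψ , eq′

  antirename* : (f : Fin n → Fin m) (t : Term n) → r ⊩* rename f t ∶ M →
                ∃[ q ] q ⊩* t ∶ M × push f q ≋ r
  antirename* f t (nil eq) = _ , nil ≋.refl , ≋.trans (push-tick f 0ᶜ) eq
  antirename* f t (cons Φ Φs eq) =
    let q₁ , Ψ , eq₁ = antirename f t Φ
        q₂ , Ψs , eq₂ = antirename* f t Φs
    in _ , cons Ψ Ψs ≋.refl , ≋.trans (push-⊞ f q₁ q₂) (≋.trans (≋.∙-cong eq₁ eq₂) eq)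

-- Anti-substitution

infix 4 _⊩ˢ_∶_
infixr 5 _∷⟨_⟩_

-- r ⊩ˢ θ ∶ q: spending r, θ provides what q requires of every variable, as well
-- as the counters of q.
data _⊩ˢ_∶_ {m} : Res m → (Fin n → Term m) → Res n → Set where
  nil    : ∀ {θ : Fin 0 → Term m} → tick k ≋ r → r ⊩ˢ θ ∶ ([] ▹ k)
  _∷⟨_⟩_ : ∀ {θ : Fin (suc n) → Term m} →
           r₁ ⊩* θ zero ∶ M → r₁ ⊞ r₂ ≋ r → r₂ ⊩ˢ θ ∘ suc ∶ (Γ ▹ k) →
           r ⊩ˢ θ ∶ (M ∷ Γ ▹ k)

⊩ˢ-resp : {θ : Fin n → Term m} {Θ : Res n} → r ≋ q → r ⊩ˢ θ ∶ Θ → q ⊩ˢ θ ∶ Θ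
⊩ˢ-resp r≋q (nil eq)       = nil (≋.trans eq r≋q)
⊩ˢ-resp r≋q (Φ ∷⟨ eq ⟩ Φs) = Φ ∷⟨ ≋.trans eq r≋q ⟩ Φs

⊩ˢ-⊞ : {θ : Fin n → Term m} → r₁ ⊩ˢ θ ∶ q₁ → r₂ ⊩ˢ θ ∶ q₂ → r₁ ⊞ r₂ ⊩ˢ θ ∶ q₁ ⊞ q₂
⊩ˢ-⊞ (nil eq₁) (nil eq₂) = nil (≋.trans (tick-+ _ _) (≋.∙-cong eq₁ eq₂))
⊩ˢ-⊞ (Φ₁ ∷⟨ eq₁ ⟩ Φs₁) (Φ₂ ∷⟨ eq₂ ⟩ Φs₂) =
  ⊩*-++ Φ₁ Φ₂ ∷⟨ ≋.trans (≋.interchange _ _ _ _) (≋.∙-cong eq₁ eq₂) ⟩ ⊩ˢ-⊞ Φs₁ Φs₂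

⊩ˢ-tick : (θ : Fin n → Term m) (k : Counters) → tick k ⊩ˢ θ ∶ tick k
⊩ˢ-tick {zero}  θ k = nil ≋.refl
⊩ˢ-tick {suc n} θ k = nil ≋.refl ∷⟨ ≋.identityˡ _ ⟩ ⊩ˢ-tick (θ ∘ suc) k

⊩ˢ-↦ : (θ : Fin n → Term m) (x : Fin n) → r ⊩ θ x ∶ σ → r ⊩ˢ θ ∶ x ↦ (σ ∷ [])
⊩ˢ-↦ θ zero    Φ =
  cons Φ (nil ≋.refl) ≋.refl ∷⟨ ≋.trans (≋.identityʳ _) (≋.identityʳ _) ⟩
  ⊩ˢ-tick (θ ∘ suc) 0ᶜ
⊩ˢ-↦ θ (suc x) Φ = nil ≋.refl ∷⟨ ≋.identityˡ _ ⟩ ⊩ˢ-↦ (θ ∘ suc) x Φ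

⊩ˢ-var : (f : Fin n → Fin m) → r ⊩ˢ var ∘ f ∶ q → push f q ≋ r
⊩ˢ-var f (nil eq)       = eq
⊩ˢ-var {q = M ∷ Γ ▹ k} f (Φ ∷⟨ eq ⟩ Φs) =
  ≋.trans (push-◂ f (Γ ▹ k)) (≋.trans (≋.∙-cong (⊩*-var Φ) (⊩ˢ-var (f ∘ suc) Φs)) eq)

-- Weakened terms do not contain variable `zero`: anti-renaming along `suc` shows that they ask
-- nothing of it.
⊩ˢ-strengthen : {θ : Fin n → Term m} → r ⊩ˢ rename suc ∘ θ ∶ q →
                ∃[ r′ ] r′ ⊩ˢ θ ∶ q × [] ◂ r′ ≋ r
⊩ˢ-strengthen (nil eq) = _ , nil ≋.refl , eq
⊩ˢ-strengthen {θ = θ} (Φ ∷⟨ eq ⟩ Φs) =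
  let q₁ , Ψ , eq₁ = antirename* suc (θ zero) Φ
      q₂ , Ψs , eq₂ = ⊩ˢ-strengthen Φs
  in _ , Ψ ∷⟨ ≋.refl ⟩ Ψs ,
     ≋.trans (≋.∙-cong (≋.trans (≋.sym (push-suc q₁)) eq₁) eq₂) eq

-- Under a binder the new variable is provided by itself and by no other entry of `extˢ θ`, so what
-- is spent on it is what is required of it.
⊩ˢ-extˢ : {θ : Fin n → Term m} → M ◂ r ⊩ˢ extˢ θ ∶ N ∷ Γ ▹ k →
          (N ↭ M) × (r ⊩ˢ θ ∶ Γ ▹ k)
⊩ˢ-extˢ {N = N} (Φ ∷⟨ eq ⟩ Φs) =
  let q , Ψs , eq′ = ⊩ˢ-strengthen Φs
      N↭M , q≋r = ◂-uncong (≋.trans (≋.∙-cong (⊩*-var Φ) eq′) eq)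
  in ↭-trans (↭-sym (++-identityʳ N)) N↭M ,
     ⊩ˢ-resp (≋.trans (≋.sym (≋.identityˡ q)) q≋r) Ψs

mutual
  antisub : (θ : Fin n → Term m) (t : Term n) → r ⊩ sub θ t ∶ σ →
            ∃[ q ] q ⊩ t ∶ σ × r ⊩ˢ θ ∶ q
  -- The derivation of `θ x` moves into the substitution as a one-element family, and an axiom takes
  -- its place.
  antisub θ (var x) Φ = _ , var ≋.refl , ⊩ˢ-↦ θ x Φ
  antisub θ (t · u) (app R Φ Ψ eq) =
    let q₁ , Φ′ , Θ₁ = antisub θ t Φ
        q₂ , Ψ′ , Θ₂ = antisub θ u Ψ
    in _ , app R Φ′ Ψ′ ≋.refl , ⊩ˢ-resp eq (⊩ˢ-⊞ (⊩ˢ-tick θ _) (⊩ˢ-⊞ Θ₁ Θ₂))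
  antisub θ (ƛ t) (lam R Φ eq) =
    let q , Φ′ , Θ = antisub-extˢ θ t Φ
    in _ , lam R Φ′ ≋.refl , ⊩ˢ-resp eq (⊩ˢ-⊞ (⊩ˢ-tick θ _) Θ)
  antisub θ (! t) (bang R Φ eq) =
    let q , Φ′ , Θ = antisub* θ t Φ
    in _ , bang R Φ′ ≋.refl , ⊩ˢ-resp eq (⊩ˢ-⊞ (⊩ˢ-tick θ _) Θ)
  antisub θ (der t) (derel R Φ eq) =
    let q , Φ′ , Θ = antisub θ t Φ
    in _ , derel R Φ′ ≋.refl , ⊩ˢ-resp eq (⊩ˢ-⊞ (⊩ˢ-tick θ _) Θ)
  antisub θ (t [∖ u ]) (cut R Φ Ψ eq) =
    let q₁ , Φ′ , Θ₁ = antisub-extˢ θ t Φ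
        q₂ , Ψ′ , Θ₂ = antisub θ u Ψ
    in _ , cut R Φ′ Ψ′ ≋.refl , ⊩ˢ-resp eq (⊩ˢ-⊞ Θ₁ Θ₂)

  antisub-extˢ : (θ : Fin n → Term m) (t : Term (suc n)) →
                 M ◂ r ⊩ sub (extˢ θ) t ∶ σ →
                 ∃[ q ] M ◂ q ⊩ t ∶ σ × r ⊩ˢ θ ∶ q
  antisub-extˢ θ t Φ with antisub (extˢ θ) t Φ
  ... | N ∷ Δ ▹ k , Ψ , Θ =
    let N↭M , Θ′ = ⊩ˢ-extˢ Θ
    in (Δ ▹ k) , ⊩-resp (◂-cong N↭M ≋.refl) Ψ , Θ′

  antisub* : (θ : Fin n → Term m) (t : Term n) → r ⊩* sub θ t ∶ M →
             ∃[ q ] q ⊩* t ∶ M × r ⊩ˢ θ ∶ q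
  antisub* θ t (nil eq) = _ , nil ≋.refl , ⊩ˢ-resp eq (⊩ˢ-tick θ 0ᶜ)
  antisub* θ t (cons Φ Φs eq) =
    let q₁ , Ψ , Θ₁ = antisub θ t Φ
        q₂ , Ψs , Θ₂ = antisub* θ t Φs
    in _ , cons Ψ Ψs ≋.refl , ⊩ˢ-resp eq (⊩ˢ-⊞ Θ₁ Θ₂)

-- Subject expansion

cost : Rule → Counters
cost dB = 1ᵇ
cost s! = 1ᵉ
cost d! = 1ᵉ

-- The part q of the resource of the hole that comes from the outer scope can be
-- taken out of the list context, which is what moving a term out of L requires.
expose : {L : LCtx n m} {t : Term m} → r ⊩ L L⟨ t ⟩ ∶ σ →
         ∃[ r₀ ] r₀ ⊩ t ∶ σ ×
         (∀ k p q → tick k ⊞ r₀ ≋ p ⊞ push (under L) q →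
          ∃[ p′ ] tick k ⊞ r ≋ p′ ⊞ q ×
                  (∀ {u τ} → p ⊩ u ∶ τ → p′ ⊩ L L⟨ u ⟩ ∶ τ))
expose {L = □} Φ =
  _ , Φ , λ k p q eq → p , ≋.trans eq (≋.∙-congˡ (push-id q)) , id
expose {L = L [∖ u ]} (cut {r₁ = r₁} {r₂ = r₂} R Φ Ψ eq) with expose {L = L} Φ
-- `q` comes from outside the cut, hence enters its body with the empty multiset at the bound
-- variable.
... | r₀ , Φ₀ , plug = r₀ , Φ₀ , λ k p q eq₀ → rebuild k q
        (plug k p ([] ◂ q) (≋.trans eq₀ (≋.∙-congˡ {x = p} (push-weaken (under L) q))))
  where
  rebuild : ∀ {p} k q →
    ∃[ p₁ ] tick k ⊞ (_ ◂ r₁) ≋ p₁ ⊞ ([] ◂ q) ×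
            (∀ {u τ} → p ⊩ u ∶ τ → p₁ ⊩ L L⟨ u ⟩ ∶ τ) →
    ∃[ p′ ] tick k ⊞ _ ≋ p′ ⊞ q × (∀ {u τ} → p ⊩ u ∶ τ → p′ ⊩ _ ∶ τ)
  rebuild k q (N ∷ Δ ▹ k₁ , eq₁ , plug₁) =
    -- As `q` has nothing at the bound variable, removing it leaves all of `M` behind, and the rule
    -- `R` still applies.
    let M↭N , eq₁′ = ◂-uncong eq₁
        N↭M = ↭-sym (↭-trans M↭N (++-identityʳ N))
        p₁  = Δ ▹ k₁
    in p₁ ⊞ r₂ ,
       (≋.begin
          tick k ⊞ _          ≋.≈⟨ ≋.∙-congˡ eq ⟨
          tick k ⊞ (r₁ ⊞ r₂)  ≋.≈⟨ ≋.assoc (tick k) r₁ r₂ ⟨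
          (tick k ⊞ r₁) ⊞ r₂  ≋.≈⟨ ≋.∙-congʳ eq₁′ ⟩
          (p₁ ⊞ q) ⊞ r₂       ≋.≈⟨ ≋.xy∙z≈xz∙y p₁ q r₂ ⟩
          (p₁ ⊞ r₂) ⊞ q       ≋.∎) ,
       λ Φ₁ → cut R (⊩-resp (◂-cong N↭M ≋.refl) (plug₁ Φ₁)) Ψ ≋.refl

-- Undoing a dB-step turns a cut into an application of an abstraction; each cut rule has a
-- consuming application rule with the same condition on the argument.
es⇒ae : CutRule M ρ → AppRule (M ⇒ τ) ρ 1ᵇ τ
es⇒ae (esₚ tight) = ae₂ tight
es⇒ae es          = ae₁

root-expansion : ∀ {κ} {t u : Term n} → t ↦⟨ κ ⟩ u → r ⊩ u ∶ σ →
                 tick (cost κ) ⊞ r ⊩ t ∶ σ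
root-expansion (dB L t u) Φ with expose {L = L} Φ
... | r₀ , cut {r₁ = r₁} R Φ₁ Φ₂ eq , plug =
  -- The argument, renamed under `L`, is pulled back to the outer scope; its resource `q` is what
  -- leaves `L`. The unit of b is spent outside, hence `0ᶜ` below.
  let q , Φ₂′ , eq₂ = antirename (under L) u Φ₂
      p , eq′ , plugᵖ = plug 0ᶜ r₁ q (≋.trans (≋.identityˡ _)
                          (≋.trans (≋.sym eq) (≋.∙-congˡ (≋.sym eq₂))))
  in app (es⇒ae R) (plugᵖ (lam ai Φ₁ (≋.identityˡ _))) Φ₂′
         (≋.∙-congˡ (≋.trans (≋.sym eq′) (≋.identityˡ _)))
root-expansion (s! L t u) Φ with expose {L = L} Φ
... | r₀ , Φ₀ , plug with antisub (single u) (rename (ext (under L)) t) Φ₀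
... | M ∷ Δ ▹ k , Φ₁ , (_∷⟨_⟩_ {r₁ = p₀} Ψ eq Ψs) =
  let q , Φ₁′ , eq₁ = antirename-ext {M = M} (under L) t Φ₁
      -- Beyond `zero`, `single u` is `var`, so it spends exactly what is required.
      Δ≋ = ≋.trans (≋.sym (push-id _)) (⊩ˢ-var id Ψs)
      -- `p₀` pays for the copies of `u` and `1ᵉ` for the bang around them; `q`, the share of `t`,
      -- leaves `L`.
      p , eq′ , plugᵖ = plug 1ᵉ (tick 1ᵉ ⊞ p₀) q
        (≋.trans (≋.∙-congˡ (≋.sym eq))
        (≋.trans (≋.sym (≋.assoc _ _ _))
                 (≋.∙-congˡ (≋.sym (≋.trans eq₁ Δ≋)))))
  in cut es Φ₁′ (plugᵖ (bang bg Ψ ≋.refl)) (≋.trans (≋.comm _ _) (≋.sym eq′))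
root-expansion (d! L t) Φ with expose {L = L} Φ
... | r₀ , Φ₀ , plug =
  -- Nothing leaves `L` here; the extra `1ᵉ` is spent in the hole, on a bang over a singleton
  -- family.
  let p , eq′ , plugᵖ = plug 1ᵉ (tick 1ᵉ ⊞ r₀) (tick 0ᶜ)
        (≋.sym (≋.trans (≋.∙-congˡ (push-tick (under L) 0ᶜ)) (≋.identityʳ _)))
  in derel dr (plugᵖ (bang bg (cons Φ₀ (nil ≋.refl) (≋.identityʳ _)) ≋.refl))
         (≋.trans (≋.comm _ p) (≋.sym eq′))

weak-expansion : (W : WCtx n m) {t u : Term m} {κ : Counters} →
                 (∀ {r σ} → r ⊩ u ∶ σ → tick κ ⊞ r ⊩ t ∶ σ) →
                 r ⊩ W W⟨ u ⟩ ∶ σ → tick κ ⊞ r ⊩ W W⟨ t ⟩ ∶ σ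
weak-expansion □ h Φ = h Φ
weak-expansion (W ·ˡ u) h (app R Φ Ψ eq) = app R (weak-expansion W h Φ) Ψ
  (≋.trans (≋.∙-congˡ (≋.assoc _ _ _)) (≋.trans (≋.x∙yz≈y∙xz _ _ _) (≋.∙-congˡ eq)))
weak-expansion (u ·ʳ W) h (app R Φ Ψ eq) = app R Φ (weak-expansion W h Ψ)
  (≋.trans (≋.∙-congˡ (≋.x∙yz≈y∙xz _ _ _)) (≋.trans (≋.x∙yz≈y∙xz _ _ _) (≋.∙-congˡ eq)))
-- A tick has the empty multiset at the binder, so `tick κ ⊞ (M ◂ r)` computes to
-- `M ◂ (tick κ ⊞ r)`.
weak-expansion (ƛ W) h (lam R Φ eq) = lam R (weak-expansion W h Φ)
  (≋.trans (≋.x∙yz≈y∙xz _ _ _) (≋.∙-congˡ eq))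
weak-expansion (der W) h (derel R Φ eq) = derel R (weak-expansion W h Φ)
  (≋.trans (≋.x∙yz≈y∙xz _ _ _) (≋.∙-congˡ eq))
weak-expansion (W [∖ u ]ˡ) h (cut R Φ Ψ eq) = cut R (weak-expansion W h Φ) Ψ
  (≋.trans (≋.assoc _ _ _) (≋.∙-congˡ eq))
weak-expansion (t [∖ W ]ʳ) h (cut R Φ Ψ eq) = cut R Φ (weak-expansion W h Ψ)
  (≋.trans (≋.x∙yz≈y∙xz _ _ _) (≋.∙-congˡ eq))

step-expansion : ∀ {κ} {t u : Term n} → t →w⟨ κ ⟩ u → r ⊩ u ∶ σ →
                 tick (cost κ) ⊞ r ⊩ t ∶ σ
step-expansion (closure W t↦u) = weak-expansion W (root-expansion t↦u)

opaque
  unfolding _+ᶜ_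

  -- With `_+ᶜ_` unfolded, adding the cost of a step on the left computes to a successor in b or e
  -- and leaves s alone.
  expansion : ∀ {t p : Term n} {b e s} → t ↠w⟨ b , e ⟩ p →
              Γ ▹ (0 , 0 , s) ⊩ p ∶ σ → Γ ▹ (b , e , s) ⊩ t ∶ σ
  expansion done            Φ = Φ
  expansion (step-dB t→u d) Φ =
    ⊩-resp (⊕-identityˡ _ , refl) (step-expansion t→u (expansion d Φ))
  expansion (step-s! t→u d) Φ =
    ⊩-resp (⊕-identityˡ _ , refl) (step-expansion t→u (expansion d Φ))
  expansion (step-d! t→u d) Φ =
    ⊩-resp (⊕-identityˡ _ , refl) (step-expansion t→u (expansion d Φ))

-- Normal forms are tightly typable

Tightly : Term n → TightConstant → Set
Tightly t c = ∃[ Γ ] Tightᶜ Γ × (Γ ▹ (0 , 0 , ∣ t ∣w) ⊩ t ∶ tt c)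

∅-tight : Tightᶜ {n} ∅
∅-tight {zero}  = []
∅-tight {suc n} = [] ∷ ∅-tight

↦-tight : (x : Fin n) → Tightᶜ (∅ [ x ]≔ (tt 𝚗 ∷ []))
↦-tight zero    = (tt 𝚗 ∷ []) ∷ ∅-tight
↦-tight (suc x) = [] ∷ ↦-tight x

⊕-tight : {Γ Δ : Ctx n} → Tightᶜ Γ → Tightᶜ Δ → Tightᶜ (Γ ⊕ Δ)
⊕-tight []       []       = []
⊕-tight (p ∷ ps) (q ∷ qs) = All.++⁺ p q ∷ ⊕-tight ps qs

opaque
  unfolding _+ᶜ_

  es-tightly : ∀ {c} {t : Term (suc n)} {u} → Tightly t c → Tightly u 𝚗 → Tightly (t [∖ u ]) c
  es-tightly (M ∷ Γ , (p ∷ ps) , Φ) (Δ , qs , Ψ) =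
    Γ ⊕ Δ , ⊕-tight ps qs , cut {r₁ = Γ ▹ _} (esₚ p) Φ Ψ ≋.refl

  mutual
    -- The grammar mirrors the side conditions: heads and cut arguments are neutral and get `𝚗`,
    -- application arguments avoid `𝚊`, and the body of an abstraction may have any tight constant.
    ne-tightly : {t : Term n} → Ne t → Tightly t 𝚗
    ne-tightly (var x) = _ , ↦-tight x , var ≋.refl
    ne-tightly (t · u) =
      let Γ , ps , Φ = ne-tightly t
          c , c≢𝚊 , Δ , qs , Ψ = na-tightly u
      in _ , ⊕-tight ps qs , app (aeₚ c≢𝚊) Φ Ψ (⊕-identityˡ _ , refl)
    ne-tightly (der t) =
      let Γ , ps , Φ = ne-tightly t
      in _ , ps , derel drₚ Φ (⊕-identityˡ _ , refl)
    ne-tightly (t [∖ u ]) = es-tightly (ne-tightly t) (ne-tightly u)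

    na-tightly : {t : Term n} → Na t → ∃[ c ] c ≢ 𝚊 × Tightly t c
    na-tightly (! t)  = 𝚋 , (λ ()) , ∅ , ∅-tight , bang bgₚ (nil ≋.refl) (≋.identityˡ _)
    na-tightly (ne t) = 𝚗 , (λ ()) , ne-tightly t
    na-tightly (t [∖ u ]) =
      let c , c≢𝚊 , T = na-tightly t in c , c≢𝚊 , es-tightly T (ne-tightly u)

  mutual
    nb-tightly : {t : Term n} → Nb t → ∃[ c ] Tightly t c
    nb-tightly (ne t) = 𝚗 , ne-tightly t
    nb-tightly (ƛ t) with no-tightly t
    ... | c , M ∷ Γ , (p ∷ ps) , Φ =
      𝚊 , Γ , ps , lam {r₁ = Γ ▹ _} (aiₚ p) Φ (⊕-identityˡ _ , refl)
    nb-tightly (t [∖ u ]) =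
      let c , T = nb-tightly t in c , es-tightly T (ne-tightly u)

    no-tightly : {t : Term n} → No t → ∃[ c ] Tightly t c
    no-tightly (na t) = let c , _ , T = na-tightly t in c , T
    no-tightly (nb t) = nb-tightly t

-- Soundness with respect to system 𝓔

mutual
  ≈-refl : ∀ σ → σ ≈ σ
  ≈-refl (tt c)  = tt c
  ≈-refl (ms M)  = ms (refl (≈-refl* M))
  ≈-refl (M ⇒ σ) = refl (≈-refl* M) ⇒ ≈-refl σ

  ≈-refl* : ∀ M → List.Pointwise _≈_ M M
  ≈-refl* []      = []
  ≈-refl* (σ ∷ M) = ≈-refl σ ∷ ≈-refl* M

↭⇒≈ₘ : M ↭ N → M ≈ₘ N
↭⇒≈ₘ refl         = refl (≈-refl* _)
↭⇒≈ₘ (prep σ p)   = prep (≈-refl σ) (↭⇒≈ₘ p)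
↭⇒≈ₘ (swap σ τ p) = swap (≈-refl σ) (≈-refl τ) (↭⇒≈ₘ p)
↭⇒≈ₘ (trans p q)  = trans (↭⇒≈ₘ p) (↭⇒≈ₘ q)

infix 4 _⊢_∶_

_⊢_∶_ : Res n → Term n → Type → Set
(Γ ▹ (b , e , s)) ⊢ t ∶ σ = Γ ⊢⟨ b , e , s ⟩ t ∶ σ

-- All resource equations are discharged through `conv` here, with the type left as it is.
⊢-resp : ∀ {t} → r ≋ q → r ⊢ t ∶ σ → q ⊢ t ∶ σ
⊢-resp (p , refl) Φ = conv Φ (Pointwise.map ↭⇒≈ₘ p) (≈-refl _)

opaque
  unfolding _+ᶜ_

  spend : ∀ {t} k → tick k ⊞ r ≋ q → (ctx r ▹ k +ᶜ cnt r) ⊢ t ∶ σ → q ⊢ t ∶ σ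
  spend k eq = ⊢-resp (≋.trans (Pointwise.sym ↭-sym (⊕-identityˡ _) , refl) eq)

  +1ᵇ : ∀ {t b e s} → Γ ⊢⟨ b + 1 , e , s ⟩ t ∶ σ → Γ ⊢⟨ 1 + b , e , s ⟩ t ∶ σ
  +1ᵇ {b = b} Φ rewrite ℕ.+-comm b 1 = Φ

  +1ˢ : ∀ {t b e s} → Γ ⊢⟨ b , e , s + 1 ⟩ t ∶ σ → Γ ⊢⟨ b , e , 1 + s ⟩ t ∶ σ
  +1ˢ {s = s} Φ rewrite ℕ.+-comm s 1 = Φ

  mutual
    sound : ∀ {t} → r ⊩ t ∶ σ → r ⊢ t ∶ σ
    sound (var eq) = ⊢-resp eq (ax _)
    sound (app {k = k} (aeₚ c≢𝚊) Φ Ψ eq) =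
      spend k eq (+1ˢ (aeₚ (sound Φ) (sound Ψ) c≢𝚊))
    sound (app {k = k} ae₁ Φ Ψ eq) = spend k eq (+1ᵇ (ae₁ (sound Φ) (sound Ψ)))
    sound (app {k = k} (ae₂ tight) Φ Ψ eq) =
      spend k eq (+1ᵇ (ae₂ (sound Φ) (sound Ψ) tight))
    sound (lam {k = k} (aiₚ tight) Φ eq) = spend k eq (+1ˢ (aiₚ (sound Φ) tight))
    sound (lam {k = k} ai Φ eq) = spend k eq (ai (sound Φ))
    sound (bang bgₚ (nil eq₀) eq) =
      ⊢-resp (≋.trans (≋.sym (≋.identityˡ _)) (≋.trans (≋.∙-congˡ eq₀) eq)) bgₚ
    sound (bang {k = k} bg Φ eq) =
      let Γ , b , e , s , Ψ , eq₀ = sound* Φ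
      in spend k (≋.trans (≋.∙-congˡ eq₀) eq) (bg Ψ)
    sound (derel {k = k} drₚ Φ eq) = spend k eq (+1ˢ (drₚ (sound Φ)))
    sound (derel {k = k} dr Φ eq) = spend k eq (dr (sound Φ))
    sound (cut (esₚ tight) Φ Ψ eq) = ⊢-resp eq (esₚ (sound Φ) (sound Ψ) tight)
    sound (cut es Φ Ψ eq) = ⊢-resp eq (es (sound Φ) (sound Ψ))

    -- Families have no conversion rule, so the indices are the literal sums; their comparison with
    -- `r` is passed on and absorbed after `bg`.
    sound* : ∀ {t} → r ⊩* t ∶ M →
             ∃[ Γ ] ∃[ b ] ∃[ e ] ∃[ s ]
             Γ ⊢*⟨ b , e , s ⟩ t ∶ M × (Γ ▹ (b , e , s)) ≋ r
    sound* (nil eq) = ∅ , 0 , 0 , 0 , [] , eq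
    sound* (cons Φ Φs eq) =
      let Δ , b , e , s , Ψs , eq₀ = sound* Φs
      in _ , _ , _ , _ , sound Φ ∷ Ψs , ≋.trans (≋.∙-congˡ eq₀) eq

theorem5p17 : ∀ {n : ℕ} (t p : Term n) (b e : ℕ) →
    t ↠w⟨ b , e ⟩ p → No p →
    ∃[ Γ ] ∃[ σ ] Σ[ Φ ∈ Γ ⊢⟨ b , e , ∣ p ∣w ⟩ t ∶ σ ] TightDerivation Φ
theorem5p17 t p b e t↠p p∈no =
  let c , Γ , tight , Φ = no-tightly p∈no
  in Γ , tt c , sound (expansion t↠p Φ) , tight , tt c
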